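{- For every permutation $\pi\in\mathcal{S}_n$ ($n\ge1$), $$\mathrm{lbsum}(\pi)=(2\text{ - }1)\pi+(1\text{ - }\bar4\text{ - }3\text{ - }\bar4\text{ - }2)\pi .$$
   Context: $\mathcal{S}_n$ is the set of permutations $\pi=\pi_1\cdots\pi_n$ of $\{1,\ldots,n\}$. The left border number $a_i$ of $\pi$ is the largest position $m<i$ with $\pi_m>\pi_i$, or $0$ if no such position exists, and $\mathrm{lbsum}(\pi)=a_1+\cdots+a_n$. For a pattern $\sigma$, $(\sigma)\pi$ denotes the number of occurrences of $\sigma$ in $\pi$. Thus $(2\text{ - }1)\pi$ is the number of inversions of $\pi$, i.e. of pairs $i<j$ with $\pi_i>\pi_j$. The symbol $1\text{ - }\bar4\text{ - }3\text{ - }\bar4\text{ - }2$ denotes a pattern $1\text{ - }3\text{ - }2$ which is part (in the roles of the letters $1,3,2$) of neither a $1\text{ - }4\text{ - }3\text{ - }2$ nor a $1\text{ - }3\text{ - }4\text{ - }2$ pattern. That is, $(1\text{ - }\bar4\text{ - }3\text{ - }\bar4\text{ - }2)\pi$ is the number of triples $i<k<j$ with $\pi_i<\pi_j<\pi_k$ such that there is no position $l$ with $i<l<j$ and $\pi_l>\pi_k$. -}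

module Defs where

open import Data.Fin.Base using (Fin; toℕ; _<_)
open import Data.Fin.Permutation using (Permutation′; _⟨$⟩ʳ_)
open import Data.Fin.Properties using (_<?_; all?; any?)
open import Data.List.Base
  using (List; []; _∷_; map; filter; length; allFin; cartesianProductWith)
open import Data.Nat.ListAction using (sum)
open import Data.List.Extrema.Nat using (max)
import Data.Nat.Base as ℕ
open ℕ using (ℕ; zero; suc)
import Data.Nat.Properties as ℕ
open import Data.Product.Base using (∃; _×_; _,_; uncurry)
open import Data.Vec.Base using (Vec; []; _∷_; lookup)
open import Data.Vec.Relation.Unary.AllPairs using (AllPairs; allPairs?)
open import Function.Base using (_∘_)
open import Function.Bundles using (_⇔_; mk⇔; Equivalence)
open import Relation.Nullary using (¬_; Dec; ¬?)
open import Relation.Nullary.Decidable using (map′; _×-dec_; _→-dec_)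
open import Relation.Unary using (Pred; Decidable)
open import Level using (0ℓ)

private
  variable
    k n : ℕ

-- A permutation π₁⋯πₙ is a bijection π of Fin n, with πᵢ = π ⟨$⟩ʳ i.  Positions
-- and letters are numbered from 0.  Only the order of the letters is used
-- below; positions are shifted back to 1, …, n where their value matters.

IsBigOnLeft : Permutation′ n → Fin n → Pred (Fin n) 0ℓ
IsBigOnLeft π i m = m < i × π ⟨$⟩ʳ i < π ⟨$⟩ʳ m

isBigOnLeft? : (π : Permutation′ n) (i : Fin n) → Decidable (IsBigOnLeft π i)
isBigOnLeft? π i m = (m <? i) ×-dec (π ⟨$⟩ʳ i <? π ⟨$⟩ʳ m)

-- The first argument of max is its value on the empty list; the position m is
-- counted from 1, hence suc (toℕ m).

leftBorder : Permutation′ n → Fin n → ℕ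
leftBorder {n} π i =
  max 0 (map (suc ∘ toℕ) (filter (isBigOnLeft? π i) (allFin n)))

lbsum : Permutation′ n → ℕ
lbsum {n} π = sum (map (leftBorder π) (allFin n))

-- A classical pattern σ₁-⋯-σₖ is the vector of its letters.  It occurs in π at
-- positions p₁ < ⋯ < pₖ if the letters of π there are in the same relative
-- order as the letters of σ.  There is no adjacency condition.

record IsOccurrence (σ : Vec ℕ k) (π : Permutation′ n) (p : Vec (Fin n) k) : Set where
  constructor mkOccurrence
  field
    increasing : AllPairs _<_ p
    sameOrder  : ∀ a b →
      lookup σ a ℕ.< lookup σ b ⇔ π ⟨$⟩ʳ lookup p a < π ⟨$⟩ʳ lookup p b

isOccurrence? : (σ : Vec ℕ k) (π : Permutation′ n) → Decidable (IsOccurrence σ π)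
isOccurrence? σ π p =
  map′ (uncurry mkOccurrence)
       (λ o → IsOccurrence.increasing o , IsOccurrence.sameOrder o)
       (allPairs? _<?_ p ×-dec all? λ a → all? λ b →
         ⇔-dec (lookup σ a ℕ.<? lookup σ b)
               (π ⟨$⟩ʳ lookup p a <? π ⟨$⟩ʳ lookup p b))
  where
  ⇔-dec : {A B : Set} → Dec A → Dec B → Dec (A ⇔ B)
  ⇔-dec a? b? = map′ (uncurry mk⇔) (λ e → Equivalence.to e , Equivalence.from e)
                     ((a? →-dec b?) ×-dec (b? →-dec a?))

tuples : ∀ k n → List (Vec (Fin n) k)
tuples zero    n = [] ∷ []
tuples (suc k) n = cartesianProductWith _∷_ (allFin n) (tuples k n)

count : {P : Pred (Vec (Fin n) k) 0ℓ} → Decidable P → ℕ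
count {n} {k} P? = length (filter P? (tuples k n))

infix 8 ⦅_⦆_

⦅_⦆_ : Vec ℕ k → Permutation′ n → ℕ
⦅ σ ⦆ π = count (isOccurrence? σ π)

-- ¬4 stands for a barred 4: an occurrence of 1-3-2 that cannot be extended, by
-- a position l for the letter 4, to an occurrence of 1-4-3-2 or of 1-3-4-2.

IsOccurrence-1¬43¬42 : Permutation′ n → Pred (Vec (Fin n) 3) 0ℓ
IsOccurrence-1¬43¬42 π p@(i ∷ m ∷ j ∷ []) =
    IsOccurrence (1 ∷ 3 ∷ 2 ∷ []) π p
  × ¬ (∃ λ l → IsOccurrence (1 ∷ 4 ∷ 3 ∷ 2 ∷ []) π (i ∷ l ∷ m ∷ j ∷ []))
  × ¬ (∃ λ l → IsOccurrence (1 ∷ 3 ∷ 4 ∷ 2 ∷ []) π (i ∷ m ∷ l ∷ j ∷ []))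

isOccurrence-1¬43¬42? : (π : Permutation′ n) → Decidable (IsOccurrence-1¬43¬42 π)
isOccurrence-1¬43¬42? π p@(i ∷ m ∷ j ∷ []) =
        isOccurrence? (1 ∷ 3 ∷ 2 ∷ []) π p
  ×-dec ¬? (any? λ l → isOccurrence? (1 ∷ 4 ∷ 3 ∷ 2 ∷ []) π (i ∷ l ∷ m ∷ j ∷ []))
  ×-dec ¬? (any? λ l → isOccurrence? (1 ∷ 3 ∷ 4 ∷ 2 ∷ []) π (i ∷ m ∷ l ∷ j ∷ []))

⦅1-¬4-3-¬4-2⦆_ : Permutation′ n → ℕ
⦅1-¬4-3-¬4-2⦆ π = count (isOccurrence-1¬43¬42? π)

infix 8 ⦅1-¬4-3-¬4-2⦆_

{-# OPTIONS --safe #-}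

-- Number positions from 0, fix a position j and let B be its left border
-- number, which is the number of positions i < B.  Such an i either carries a
-- letter larger than πⱼ, and then (i, j) is an inversion, or it carries a
-- smaller one and some letter between i and j exceeds πⱼ.  In the latter case
-- exactly one occurrence (i, m, j) of 1-¬4-3-¬4-2 exists: πₘ has to be the
-- largest letter between i and j.  Conversely, inversions and occurrences only
-- arise from positions i < B.

module Submission where

open import Defs
open import Data.Nat.Base using (ℕ; _+_; _≥_)
open import Data.Fin.Permutation using (Permutation′)
open import Data.Vec.Base using (_∷_; [])
open import Relation.Binary.PropositionalEquality using (_≡_)

open import Data.Bool.Base using (if_then_else_; true; false)
open import Data.Fin.Base as Fin using (Fin; toℕ; _<_; _≤_)
open import Data.Fin.Patterns using (0F; 1F; 2F)
open import Data.Fin.Permutation using (_⟨$⟩ʳ_)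
open import Data.Fin.Properties as Fin using (_<?_; toℕ<n; <-cmp)
open import Data.List.Base as List using (List; map; filter; length; allFin; cartesianProductWith)
open import Data.List.Extrema.Nat using (argmax; argmax-sel; argmax-all; xs≤max; max≤v⁺; f[xs]≤f[argmax])
open import Data.List.Membership.Propositional using (_∈_)
open import Data.List.Membership.Propositional.Properties using (∈-map⁺; ∈-map⁻; ∈-filter⁺; ∈-filter⁻; ∈-allFin)
import Data.List.Properties as List
import Data.List.Relation.Unary.All as All
open import Data.List.Relation.Unary.All.Properties using (all-filter)
open import Data.Nat.Base as ℕ using (zero; suc; z≤n; s≤s; z<s)
open import Data.Nat.ListAction using (sum)
open import Data.Nat.Properties as ℕ using (+-0-commutativeMonoid)
open import Algebra.Properties.CommutativeMonoid.Sum +-0-commutativeMonoid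
  using (sum-syntax; sum-cong-≗; sum-replicate-zero; ∑-comm; ∑-distrib-+)
open import Data.Product.Base using (∃; _×_; _,_; proj₁; proj₂)
open import Data.Sum.Base as Sum using (_⊎_; inj₁; inj₂)
open import Data.Vec.Base using (Vec; lookup; zip)
open import Data.Vec.Relation.Unary.All using ([]; _∷_)
import Data.Vec.Relation.Unary.All.Properties as VecAll
open import Data.Vec.Relation.Unary.AllPairs using (AllPairs; []; _∷_)
open import Data.Vec.Properties using (lookup-zip)
open import Function.Base using (_∘_; id)
open import Function.Bundles using (_⇔_; mk⇔; Equivalence; Injection)
open import Function.Properties.Inverse using (↔⇒↣)
open import Level using (0ℓ)
open import Relation.Binary.Definitions using (tri<; tri≈; tri>)
open import Relation.Binary.PropositionalEquality
  using (refl; sym; trans; cong; cong₂; subst; module ≡-Reasoning)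
open import Relation.Nullary using (¬_; Dec; does; yes; no; contradiction; _×-dec_)
open import Relation.Nullary.Decidable using (dec-true; dec-false)
open import Relation.Unary using (Pred; Decidable)

private
  variable
    A B C P : Set
    k n : ℕ

-- Counting as summation of indicators

⟦_⟧ : Dec P → ℕ
⟦ P? ⟧ = if does P? then 1 else 0

⟦⟧-true : (P? : Dec P) → P → ⟦ P? ⟧ ≡ 1
⟦⟧-true P? p = cong (if_then 1 else 0) (dec-true P? p)

⟦⟧-false : (P? : Dec P) → ¬ P → ⟦ P? ⟧ ≡ 0
⟦⟧-false P? ¬p = cong (if_then 1 else 0) (dec-false P? ¬p)

∑-none : {P : Pred (Fin n) 0ℓ} (P? : Decidable P) → (∀ i → ¬ P i) →
         ∑[ i < n ] ⟦ P? i ⟧ ≡ 0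
∑-none {n} P? ¬P =
  trans (sum-cong-≗ λ i → ⟦⟧-false (P? i) (¬P i)) (sum-replicate-zero n)

∑-unique : {P : Pred (Fin n) 0ℓ} (P? : Decidable P) (i : Fin n) → P i →
           (∀ j → P j → j ≡ i) → ∑[ j < n ] ⟦ P? j ⟧ ≡ 1
∑-unique P? Fin.zero p unique =
  cong₂ _+_ (⟦⟧-true (P? 0F) p)
            (∑-none (P? ∘ Fin.suc) λ j q → contradiction (unique (Fin.suc j) q) λ ())
∑-unique P? (Fin.suc i) p unique =
  cong₂ _+_ (⟦⟧-false (P? 0F) λ q → contradiction (unique 0F q) λ ())
            (∑-unique (P? ∘ Fin.suc) i p λ j q → Fin.suc-injective (unique (Fin.suc j) q))

-- Turns a border number into a sum of indicators over positions, so that it can enter a double sum.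
-- Beyond `n` there would be too few positions to count.
∑-initial : ∀ {b} → b ℕ.≤ n → ∑[ i < n ] ⟦ toℕ i ℕ.<? b ⟧ ≡ b
∑-initial {n} z≤n = ∑-none {n} (λ i → toℕ i ℕ.<? 0) λ _ ()
∑-initial (s≤s b≤n) = cong suc (∑-initial b≤n)

sum-map-tabulate : (f : A → ℕ) (g : Fin n → A) →
  sum (map f (List.tabulate g)) ≡ ∑[ i < n ] f (g i)
sum-map-tabulate {n = zero}  f g = refl
sum-map-tabulate {n = suc n} f g = cong (f (g 0F) +_) (sum-map-tabulate f (g ∘ Fin.suc))

length-filter-map : {P : Pred B 0ℓ} (P? : Decidable P) (f : A → B) (xs : List A) →
  length (filter P? (map f xs)) ≡ length (filter (P? ∘ f) xs)
length-filter-map P? f List.[] = refl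
length-filter-map P? f (x List.∷ xs) with does (P? (f x))
... | true  = cong suc (length-filter-map P? f xs)
... | false = length-filter-map P? f xs

length-filter-cartesianProductWith :
  {P : Pred C 0ℓ} (P? : Decidable P) (f : A → B → C) (xs : List A) (ys : List B) →
  length (filter P? (cartesianProductWith f xs ys)) ≡
  sum (map (λ x → length (filter (P? ∘ f x) ys)) xs)
length-filter-cartesianProductWith P? f List.[]       ys = refl
length-filter-cartesianProductWith P? f (x List.∷ xs) ys = begin
  length (filter P? (map (f x) ys List.++ xs×ys))
    ≡⟨ cong length (List.filter-++ P? (map (f x) ys) xs×ys) ⟩
  length (filter P? (map (f x) ys) List.++ filter P? xs×ys)
    ≡⟨ List.length-++ (filter P? (map (f x) ys)) ⟩
  length (filter P? (map (f x) ys)) + length (filter P? xs×ys)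
    ≡⟨ cong₂ _+_ (length-filter-map P? (f x) ys)
                 (length-filter-cartesianProductWith P? f xs ys) ⟩
  length (filter (P? ∘ f x) ys) + sum (map (λ x → length (filter (P? ∘ f x) ys)) xs) ∎
  where
  open ≡-Reasoning
  xs×ys = cartesianProductWith f xs ys

count-zero : {P : Pred (Vec (Fin n) 0) 0ℓ} (P? : Decidable P) → count P? ≡ ⟦ P? [] ⟧
count-zero P? with does (P? [])
... | true  = refl
... | false = refl

count-suc : {P : Pred (Vec (Fin n) (suc k)) 0ℓ} (P? : Decidable P) →
  count P? ≡ ∑[ i < n ] count (λ p → P? (i ∷ p))
count-suc {n} {k} P? = trans
  (length-filter-cartesianProductWith P? _∷_ (allFin n) (tuples k n))
  (sum-map-tabulate (λ i → count (λ p → P? (i ∷ p))) id)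

count₂ : {P : Pred (Vec (Fin n) 2) 0ℓ} (P? : Decidable P) →
  count P? ≡ ∑[ i < n ] ∑[ j < n ] ⟦ P? (i ∷ j ∷ []) ⟧
count₂ P? = trans (count-suc P?) (sum-cong-≗ λ i →
  trans (count-suc (λ p → P? (i ∷ p))) (sum-cong-≗ λ j →
  count-zero (λ p → P? (i ∷ j ∷ p))))

count₃ : {P : Pred (Vec (Fin n) 3) 0ℓ} (P? : Decidable P) →
  count P? ≡ ∑[ i < n ] ∑[ m < n ] ∑[ j < n ] ⟦ P? (i ∷ m ∷ j ∷ []) ⟧
count₃ P? = trans (count-suc P?) (sum-cong-≗ λ i → count₂ (λ p → P? (i ∷ p)))

-- Occurrences of patterns

module _ (π : Permutation′ n) where

  -- Pairs consist of a letter of the pattern and the position matched with it.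

  Aligned : ℕ × Fin n → ℕ × Fin n → Set
  Aligned (s , p) (t , q) =
      (s ℕ.< t × π ⟨$⟩ʳ p < π ⟨$⟩ʳ q)
    ⊎ (t ℕ.< s × π ⟨$⟩ʳ q < π ⟨$⟩ʳ p)

  Aligned⇒⇔ : ∀ {s t p q} → Aligned (s , p) (t , q) → s ℕ.< t ⇔ π ⟨$⟩ʳ p < π ⟨$⟩ʳ q
  Aligned⇒⇔ (inj₁ (s<t , p<q)) = mk⇔ (λ _ → p<q) (λ _ → s<t)
  Aligned⇒⇔ (inj₂ (t<s , q<p)) =
    mk⇔ (λ s<t → contradiction s<t (ℕ.<-asym t<s))
        (λ p<q → contradiction p<q (ℕ.<-asym q<p))

  -- One comparison for each pair `a` before `b` suffices. On the diagonal both sides fail by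
  -- irreflexivity, and below it the two alternatives of `Aligned` trade places.
  sameOrder : {σ : Vec ℕ k} {p : Vec (Fin n) k} → AllPairs Aligned (zip σ p) →
    ∀ a b → lookup σ a ℕ.< lookup σ b ⇔ π ⟨$⟩ʳ lookup p a < π ⟨$⟩ʳ lookup p b
  sameOrder {σ = s ∷ σ} {p ∷ ps} _ 0F 0F =
    mk⇔ (λ s<s → contradiction s<s (ℕ.<-irrefl refl))
        (λ p<p → contradiction p<p (ℕ.<-irrefl refl))
  sameOrder {σ = s ∷ σ} {p ∷ ps} (h ∷ _) 0F (Fin.suc b) =
    Aligned⇒⇔ (subst (Aligned _) (lookup-zip b σ ps) (VecAll.lookup⁺ h b))
  sameOrder {σ = s ∷ σ} {p ∷ ps} (h ∷ _) (Fin.suc a) 0F =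
    Aligned⇒⇔ (Sum.swap (subst (Aligned _) (lookup-zip a σ ps) (VecAll.lookup⁺ h a)))
  sameOrder {σ = s ∷ σ} {p ∷ ps} (_ ∷ hs) (Fin.suc a) (Fin.suc b) = sameOrder hs a b

  private
    infix 4 _≺_
    _≺_ : Fin n → Fin n → Set
    i ≺ j = π ⟨$⟩ʳ i < π ⟨$⟩ʳ j

  occurrence-21 : ∀ {i j} →
    IsOccurrence (2 ∷ 1 ∷ []) π (i ∷ j ∷ []) ⇔ (i < j × j ≺ i)
  occurrence-21 = mk⇔
    (λ { (mkOccurrence ((i<j ∷ []) ∷ _) o) → i<j , Equivalence.to (o 1F 0F) (ℕ.n<1+n 1) })
    (λ { (i<j , j≺i) → mkOccurrence ((i<j ∷ []) ∷ [] ∷ [])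
           (sameOrder ((inj₂ (ℕ.n<1+n 1 , j≺i) ∷ []) ∷ [] ∷ [])) })

  -- Comparing letters adjacent in value is enough; 1 against 3 follows by transitivity through 2.
  occurrence-132 : ∀ {i m j} →
    IsOccurrence (1 ∷ 3 ∷ 2 ∷ []) π (i ∷ m ∷ j ∷ []) ⇔ (i < m × m < j × i ≺ j × j ≺ m)
  occurrence-132 = mk⇔
    (λ { (mkOccurrence ((i<m ∷ _) ∷ (m<j ∷ []) ∷ _) o) →
           i<m , m<j , Equivalence.to (o 0F 2F) (ℕ.n<1+n 1)
                     , Equivalence.to (o 2F 1F) (ℕ.n<1+n 2) })
    (λ { (i<m , m<j , i≺j , j≺m) → mkOccurrence
           ((i<m ∷ ℕ.<-trans i<m m<j ∷ []) ∷ (m<j ∷ []) ∷ [] ∷ [])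
           (sameOrder ( ( inj₁ (s≤s z<s , ℕ.<-trans i≺j j≺m)
                        ∷ inj₁ (s≤s z<s , i≺j) ∷ [])
                      ∷ (inj₂ (ℕ.n<1+n 2 , j≺m) ∷ []) ∷ [] ∷ [])) })

  occurrence-1432 : ∀ {i l m j} → i < l → l < m → m < j → i ≺ j → j ≺ m → m ≺ l →
    IsOccurrence (1 ∷ 4 ∷ 3 ∷ 2 ∷ []) π (i ∷ l ∷ m ∷ j ∷ [])
  occurrence-1432 i<l l<m m<j i≺j j≺m m≺l = mkOccurrence
    ( (i<l ∷ ℕ.<-trans i<l l<m ∷ ℕ.<-trans i<l (ℕ.<-trans l<m m<j) ∷ [])
    ∷ (l<m ∷ ℕ.<-trans l<m m<j ∷ [])
    ∷ (m<j ∷ []) ∷ [] ∷ [])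
    (sameOrder
      ( ( inj₁ (s≤s z<s , ℕ.<-trans i≺j (ℕ.<-trans j≺m m≺l))
        ∷ inj₁ (s≤s z<s , ℕ.<-trans i≺j j≺m)
        ∷ inj₁ (s≤s z<s , i≺j) ∷ [])
      ∷ ( inj₂ (ℕ.n<1+n 3 , m≺l)
        ∷ inj₂ (s≤s (s≤s z<s) , ℕ.<-trans j≺m m≺l) ∷ [])
      ∷ (inj₂ (ℕ.n<1+n 2 , j≺m) ∷ []) ∷ [] ∷ []))

  occurrence-1342 : ∀ {i m l j} → i < m → m < l → l < j → i ≺ j → j ≺ m → m ≺ l →
    IsOccurrence (1 ∷ 3 ∷ 4 ∷ 2 ∷ []) π (i ∷ m ∷ l ∷ j ∷ [])
  occurrence-1342 i<m m<l l<j i≺j j≺m m≺l = mkOccurrence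
    ( (i<m ∷ ℕ.<-trans i<m m<l ∷ ℕ.<-trans i<m (ℕ.<-trans m<l l<j) ∷ [])
    ∷ (m<l ∷ ℕ.<-trans m<l l<j ∷ [])
    ∷ (l<j ∷ []) ∷ [] ∷ [])
    (sameOrder
      ( ( inj₁ (s≤s z<s , ℕ.<-trans i≺j j≺m)
        ∷ inj₁ (s≤s z<s , ℕ.<-trans i≺j (ℕ.<-trans j≺m m≺l))
        ∷ inj₁ (s≤s z<s , i≺j) ∷ [])
      ∷ ( inj₁ (ℕ.n<1+n 3 , m≺l)
        ∷ inj₂ (ℕ.n<1+n 2 , j≺m) ∷ [])
      ∷ (inj₂ (s≤s (s≤s z<s) , ℕ.<-trans j≺m m≺l) ∷ []) ∷ [] ∷ []))

  -- The barred pattern and the highest letter between two positions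

  IsHighestBetween : Fin n → Fin n → Pred (Fin n) 0ℓ
  IsHighestBetween i j m = i < m × m < j × (∀ l → i < l → l < j → ¬ m ≺ l)

  -- A letter above that of `m` at a position `l` between `i` and `j` gives 1-4-3-2 if `l` is left
  -- of `m` and 1-3-4-2 if it is right of `m`. The two bars together thus say that `m` carries the
  -- highest letter in between.
  occurrence-1¬43¬42 : ∀ {i m j} →
    IsOccurrence-1¬43¬42 π (i ∷ m ∷ j ∷ []) ⇔ (i ≺ j × j ≺ m × IsHighestBetween i j m)
  occurrence-1¬43¬42 {i} {m} {j} = mk⇔ to from
    where
    to : IsOccurrence-1¬43¬42 π (i ∷ m ∷ j ∷ []) → i ≺ j × j ≺ m × IsHighestBetween i j m
    to (o , ¬1432 , ¬1342) with Equivalence.to occurrence-132 o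
    ... | i<m , m<j , i≺j , j≺m = i≺j , j≺m , i<m , m<j , highest
      where
      highest : ∀ l → i < l → l < j → ¬ m ≺ l
      highest l i<l l<j m≺l with <-cmp l m
      ... | tri< l<m _ _  = ¬1432 (l , occurrence-1432 i<l l<m m<j i≺j j≺m m≺l)
      ... | tri≈ _ refl _ = ℕ.<-irrefl refl m≺l
      ... | tri> _ _ m<l  = ¬1342 (l , occurrence-1342 i<m m<l l<j i≺j j≺m m≺l)

    from : i ≺ j × j ≺ m × IsHighestBetween i j m → IsOccurrence-1¬43¬42 π (i ∷ m ∷ j ∷ [])
    from (i≺j , j≺m , i<m , m<j , highest) =
        Equivalence.from occurrence-132 (i<m , m<j , i≺j , j≺m)
      -- In both refutations the letters 3 and 4 are compared: they have indices `2F` and `1F` in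
      -- 1-4-3-2, but `1F` and `2F` in 1-3-4-2. The result is `m ≺ l`.
      , (λ { (l , mkOccurrence ((i<l ∷ _) ∷ (l<m ∷ _) ∷ _) o) →
               highest l i<l (ℕ.<-trans l<m m<j) (Equivalence.to (o 2F 1F) (ℕ.n<1+n 3)) })
      , (λ { (l , mkOccurrence (_ ∷ (m<l ∷ _) ∷ (l<j ∷ _) ∷ _) o) →
               highest l (ℕ.<-trans i<m m<l) l<j (Equivalence.to (o 1F 2F) (ℕ.n<1+n 3)) })

  -- Neither letter can exceed the other, so they are equal and injectivity of `π` identifies the
  -- positions.
  highestBetween-unique : ∀ {i j m m′} →
    IsHighestBetween i j m → IsHighestBetween i j m′ → m ≡ m′
  highestBetween-unique {m = m} {m′} (i<m , m<j , h) (i<m′ , m′<j , h′)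
    with <-cmp (π ⟨$⟩ʳ m) (π ⟨$⟩ʳ m′)
  ... | tri< m≺m′ _ _  = contradiction m≺m′ (h m′ i<m′ m′<j)
  ... | tri≈ _ πm≡πm′ _ = Injection.injective (↔⇒↣ π) πm≡πm′
  ... | tri> _ _ m′≺m  = contradiction m′≺m (h′ m i<m m<j)

  -- The position `m` shows that there is something to maximise over. The final inequality lets
  -- `j ≺ m` be passed on to `j ≺ m′`.
  highestBetween-exists : ∀ {i j m} → i < m → m < j →
    ∃ λ m′ → IsHighestBetween i j m′ × π ⟨$⟩ʳ m ≤ π ⟨$⟩ʳ m′
  highestBetween-exists {i} {j} {m} i<m m<j =
    m′ , (proj₁ between , proj₂ between , highest) , below m i<m m<j
    where
    letter : Fin n → ℕ
    letter l = toℕ (π ⟨$⟩ʳ l)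
    between? : Decidable λ l → i < l × l < j
    between? l = (i <? l) ×-dec (l <? j)
    candidates = filter between? (allFin n)
    -- The default `m` lies between `i` and `j` itself, so the result does so in every case.
    m′ = argmax letter m candidates
    between : i < m′ × m′ < j
    between = argmax-all letter (i<m , m<j) (all-filter between? (allFin n))
    below : ∀ l → i < l → l < j → letter l ℕ.≤ letter m′
    below l i<l l<j = All.lookup (f[xs]≤f[argmax] m candidates)
      (∈-filter⁺ between? (∈-allFin l) (i<l , l<j))
    highest : ∀ l → i < l → l < j → ¬ m′ ≺ l
    highest l i<l l<j = ℕ.≤⇒≯ (below l i<l l<j)

  -- The left border number

  leftBorder≤n : ∀ j → leftBorder π j ℕ.≤ n
  leftBorder≤n j = max≤v⁺ z≤n (All.tabulate bound)
    where
    bound : ∀ {x} → x ∈ map (suc ∘ toℕ) (filter (isBigOnLeft? π j) (allFin n)) → x ℕ.≤ n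
    bound x∈ with ∈-map⁻ (suc ∘ toℕ) x∈
    ... | m , _ , refl = toℕ<n m

  -- The border number is the largest `suc (toℕ m)`, so lying strictly below it means `i ≤ m` for
  -- some larger letter on the left. The case `i ≡ m` is included because `i` is counted from 0 and
  -- the border from 1.
  <leftBorder : {i j : Fin n} →
    toℕ i ℕ.< leftBorder π j ⇔ ∃ λ m → i ≤ m × IsBigOnLeft π j m
  <leftBorder {i} {j} = mk⇔ to from
    where
    borders = map (suc ∘ toℕ) (filter (isBigOnLeft? π j) (allFin n))
    to : toℕ i ℕ.< leftBorder π j → ∃ λ m → i ≤ m × IsBigOnLeft π j m
    -- The maximum is either the default 0, which has nothing below it, or an attained border.
    to i<b with argmax-sel id 0 borders
    ... | inj₁ b≡0 = contradiction (subst (toℕ i ℕ.<_) b≡0 i<b) λ ()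
    ... | inj₂ b∈ with ∈-map⁻ (suc ∘ toℕ) b∈
    ...   | m , m∈ , b≡1+m =
      m , ℕ.s≤s⁻¹ (subst (toℕ i ℕ.<_) b≡1+m i<b) ,
      proj₂ (∈-filter⁻ (isBigOnLeft? π j) {xs = allFin n} m∈)
    from : (∃ λ m → i ≤ m × IsBigOnLeft π j m) → toℕ i ℕ.< leftBorder π j
    from (m , i≤m , big) = ℕ.≤-trans (s≤s i≤m) (All.lookup (xs≤max 0 borders)
      (∈-map⁺ (suc ∘ toℕ) (∈-filter⁺ (isBigOnLeft? π j) (∈-allFin m) big)))

  -- Stated for arbitrary deciders, as the concrete ones have unwieldy normal forms.

  <leftBorder-split : {i j : Fin n} (i<b? : Dec (toℕ i ℕ.< leftBorder π j))
    (inversion? : Dec (IsOccurrence (2 ∷ 1 ∷ []) π (i ∷ j ∷ [])))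
    (barred? : Decidable λ m → IsOccurrence-1¬43¬42 π (i ∷ m ∷ j ∷ [])) →
    ⟦ i<b? ⟧ ≡ ⟦ inversion? ⟧ + ∑[ m < n ] ⟦ barred? m ⟧
  -- An inversion puts `i` below the border with `i` itself as witness, and its `j ≺ i` rules out
  -- the `i ≺ j` of a barred occurrence.
  <leftBorder-split {i} i<b? (yes o) barred? = trans
    (⟦⟧-true i<b? (Equivalence.from <leftBorder (i , ℕ.≤-refl {toℕ i} , i<j , j≺i)))
    (cong suc (sym (∑-none barred? λ m o′ →
      ℕ.<-asym j≺i (proj₁ (Equivalence.to occurrence-1¬43¬42 o′)))))
    where
    i<j = proj₁ (Equivalence.to occurrence-21 o)
    j≺i = proj₂ (Equivalence.to occurrence-21 o)
  -- The middle position of a barred occurrence would be a larger letter left of `j` and right of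
  -- `i`, placing `i` below the border.
  <leftBorder-split (no i≮b) (no ¬o) barred? = sym (∑-none barred? λ m o →
    let _ , j≺m , i<m , m<j , _ = Equivalence.to occurrence-1¬43¬42 o
    in i≮b (Equivalence.from <leftBorder (m , ℕ.<⇒≤ i<m , m<j , j≺m)))
  -- The witness `m` for the border need not be highest between `i` and `j`; it is replaced by
  -- `top`, whose letter is at least as large and hence still above that of `j`.
  <leftBorder-split {i} {j} (yes i<b) (no ¬o) barred? = sym (∑-unique barred? top
    (Equivalence.from occurrence-1¬43¬42 (i≺j , ℕ.<-≤-trans j≺m πm≤πtop , top-highest))
    λ m o → highestBetween-unique
      (proj₂ (proj₂ (Equivalence.to occurrence-1¬43¬42 o))) top-highest)
    where
    border = Equivalence.to <leftBorder i<b
    m   = proj₁ border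
    m<j = proj₁ (proj₂ (proj₂ border))
    j≺m = proj₂ (proj₂ (proj₂ border))
    -- If `i` were equal to `m`, then `i` and `j` would form an inversion.
    i<m : i < m
    i<m = Fin.≤∧≢⇒< (proj₁ (proj₂ border)) λ i≡m → ¬o (Equivalence.from occurrence-21
      (subst (_< j) (sym i≡m) m<j , subst (j ≺_) (sym i≡m) j≺m))
    i<j = ℕ.<-trans i<m m<j
    i≺j : i ≺ j
    i≺j with <-cmp (π ⟨$⟩ʳ i) (π ⟨$⟩ʳ j)
    ... | tri< i≺j _ _ = i≺j
    ... | tri≈ _ πi≡πj _ = contradiction (Injection.injective (↔⇒↣ π) πi≡πj) (Fin.<⇒≢ i<j)
    ... | tri> _ _ j≺i = contradiction (Equivalence.from occurrence-21 (i<j , j≺i)) ¬o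
    highest     = highestBetween-exists i<m m<j
    top         = proj₁ highest
    top-highest = proj₁ (proj₂ highest)
    πm≤πtop     = proj₂ (proj₂ highest)

  -- Summation over all pairs of positions

  private
    inversion? : ∀ i j → Dec (IsOccurrence (2 ∷ 1 ∷ []) π (i ∷ j ∷ []))
    inversion? i j = isOccurrence? (2 ∷ 1 ∷ []) π (i ∷ j ∷ [])

    barred? : ∀ i j m → Dec (IsOccurrence-1¬43¬42 π (i ∷ m ∷ j ∷ []))
    barred? i j m = isOccurrence-1¬43¬42? π (i ∷ m ∷ j ∷ [])

  lbsum-split : lbsum π ≡ (⦅ 2 ∷ 1 ∷ [] ⦆ π) + (⦅1-¬4-3-¬4-2⦆ π)
  lbsum-split = begin
    lbsum π
      ≡⟨ sum-map-tabulate (leftBorder π) id ⟩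
    ∑[ j < n ] leftBorder π j
      ≡⟨ sum-cong-≗ (λ j → sym (∑-initial (leftBorder≤n j))) ⟩
    ∑[ j < n ] ∑[ i < n ] ⟦ toℕ i ℕ.<? leftBorder π j ⟧
      -- Border numbers are summed with `j` outermost, whereas `count₂` and `count₃` enumerate
      -- tuples by their first position `i`.
      ≡⟨ ∑-comm (λ (j i : Fin n) → ⟦ toℕ i ℕ.<? leftBorder π j ⟧) ⟩
    ∑[ i < n ] ∑[ j < n ] ⟦ toℕ i ℕ.<? leftBorder π j ⟧
      ≡⟨ sum-cong-≗ row ⟩
    ∑[ i < n ] (∑[ j < n ] ⟦ inversion? i j ⟧ + ∑[ m < n ] ∑[ j < n ] ⟦ barred? i j m ⟧)
      ≡⟨ ∑-distrib-+ (λ (i : Fin n) → ∑[ j < n ] ⟦ inversion? i j ⟧) _ ⟩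
    ∑[ i < n ] ∑[ j < n ] ⟦ inversion? i j ⟧ +
    ∑[ i < n ] ∑[ m < n ] ∑[ j < n ] ⟦ barred? i j m ⟧
      ≡⟨ cong₂ _+_ (count₂ (isOccurrence? (2 ∷ 1 ∷ []) π)) (count₃ (isOccurrence-1¬43¬42? π)) ⟨
    (⦅ 2 ∷ 1 ∷ [] ⦆ π) + (⦅1-¬4-3-¬4-2⦆ π) ∎
    where
    open ≡-Reasoning
    row : ∀ i → ∑[ j < n ] ⟦ toℕ i ℕ.<? leftBorder π j ⟧ ≡
                ∑[ j < n ] ⟦ inversion? i j ⟧ + ∑[ m < n ] ∑[ j < n ] ⟦ barred? i j m ⟧
    row i = begin
      ∑[ j < n ] ⟦ toℕ i ℕ.<? leftBorder π j ⟧
        ≡⟨ sum-cong-≗ (λ j → <leftBorder-split (toℕ i ℕ.<? leftBorder π j) (inversion? i j) (barred? i j)) ⟩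
      ∑[ j < n ] (⟦ inversion? i j ⟧ + ∑[ m < n ] ⟦ barred? i j m ⟧)
        ≡⟨ ∑-distrib-+ (λ j → ⟦ inversion? i j ⟧) _ ⟩
      ∑[ j < n ] ⟦ inversion? i j ⟧ + ∑[ j < n ] ∑[ m < n ] ⟦ barred? i j m ⟧
        -- The occurrences are tuples in the order `i`, `m`, `j`, so the sum over `m` has to move
        -- outside that over `j`.
        ≡⟨ cong (∑[ j < n ] ⟦ inversion? i j ⟧ +_) (∑-comm λ (j m : Fin n) → ⟦ barred? i j m ⟧) ⟩
      ∑[ j < n ] ⟦ inversion? i j ⟧ + ∑[ m < n ] ∑[ j < n ] ⟦ barred? i j m ⟧ ∎

proposition1p6 : (n : ℕ) → n ≥ 1 → (π : Permutation′ n) →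
    lbsum π ≡ (⦅ 2 ∷ 1 ∷ [] ⦆ π) + (⦅1-¬4-3-¬4-2⦆ π)
proposition1p6 n _ π = lbsum-split π
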